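{- For every integer $r\ge 3$, the value $\frac{r-2}{r-1}$ is an accumulation point of the set of real numbers $$\Delta_{\mathrm{hom}}^{(r)}:=\{\delta_{\mathrm{hom}}(H): H \text{ a graph with } \chi(H)=r\}.$$
   Context: All graphs are finite and simple. A graph is $H$-free if it contains no (not necessarily induced) subgraph isomorphic to $H$. $\delta(G)$ denotes minimum degree and $\chi$ the chromatic number. The homomorphism threshold of a graph $H$, denoted $\delta_{\mathrm{hom}}(H)$, is the infimum of all $\gamma\ge 0$ for which there exists a (finite) $H$-free graph $F=F(\gamma,H)$ such that every $H$-free graph $G$ with $\delta(G)\ge\gamma|V(G)|$ admits a graph homomorphism to $F$. -}

module Defs where

open import Level using (_⊔_; 0ℓ) renaming (suc to lsuc)
open import Data.Bool using (Bool; true; false)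
open import Data.Empty using (⊥-elim)
open import Data.Fin using (Fin)
open import Data.Fin.Subset using (Subset; ∣_∣)
open import Data.Integer using (+_)
open import Data.List using (map; allFin)
open import Data.Nat as ℕ using (ℕ; zero; suc; _∸_)
import Data.Nat.Properties as ℕP
open import Data.List.Extrema ℕP.≤-totalOrder using (min)
open import Data.Product using (_×_; _,_; proj₁; proj₂; ∃-syntax; Σ-syntax)
open import Data.Rational as ℚ using (ℚ; 0ℚ; 1ℚ; _/_)
import Data.Rational.Properties as ℚP
open import Data.Vec using (tabulate)
open import Function.Definitions using (Injective)
open import Relation.Binary.Definitions using (tri<; tri≈; tri>)
open import Relation.Binary.PropositionalEquality using (_≡_; _≢_; refl; sym; trans; cong; subst)
open import Relation.Nullary using (¬_; yes; no)

-- Two-sided Dedekind cuts in ℚ.  `L p` reads p < x and `U q` reads x < q.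
-- Locatedness is the double negation of the usual `L p ⊎ U q`: classically
-- this is the same notion, while constructively every inhabited set that is
-- bounded below has an infimum among these cuts without deciding membership.
record ℝ : Set₁ where
  field
    L U         : ℚ → Set
    L-inhabited : ∃[ p ] L p
    U-inhabited : ∃[ q ] U q
    L-lower     : ∀ {p q} → p ℚ.< q → L q → L p
    U-upper     : ∀ {p q} → p ℚ.< q → U p → U q
    L-open      : ∀ {p} → L p → ∃[ q ] (p ℚ.< q × L q)
    U-open      : ∀ {q} → U q → ∃[ p ] (p ℚ.< q × U p)
    disjoint    : ∀ {q} → ¬ (L q × U q)
    located     : ∀ {p q} → p ℚ.< q → ¬ (¬ L p × ¬ U q)

open ℝ

infix 4 _<ℝ_ _≤ℝ_ _≈ℝ_

_<ℝ_ : ℝ → ℝ → Set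
x <ℝ y = ∃[ q ] (U x q × L y q)

_≤ℝ_ : ℝ → ℝ → Set
x ≤ℝ y = ¬ (y <ℝ x)

_≈ℝ_ : ℝ → ℝ → Set
x ≈ℝ y = x ≤ℝ y × y ≤ℝ x

private
  p-1<p : ∀ p → p ℚ.- 1ℚ ℚ.< p
  p-1<p p = subst (p ℚ.- 1ℚ ℚ.<_) (ℚP.+-identityʳ p) (ℚP.+-monoʳ-< p (ℚP.negative⁻¹ (ℚ.- 1ℚ)))

  p<p+1 : ∀ p → p ℚ.< p ℚ.+ 1ℚ
  p<p+1 p = subst (ℚ._< p ℚ.+ 1ℚ) (ℚP.+-identityʳ p) (ℚP.+-monoʳ-< p (ℚP.positive⁻¹ 1ℚ))

fromℚ : ℚ → ℝ
fromℚ x = record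
  { L           = ℚ._< x
  ; U           = x ℚ.<_
  ; L-inhabited = x ℚ.- 1ℚ , p-1<p x
  ; U-inhabited = x ℚ.+ 1ℚ , p<p+1 x
  ; L-lower     = ℚP.<-trans
  ; U-upper     = λ p<q x<p → ℚP.<-trans x<p p<q
  ; L-open      = ℚP.<-dense
  ; U-open      = λ x<q → let (m , x<m , m<q) = ℚP.<-dense x<q in m , m<q , x<m
  ; disjoint    = λ (q<x , x<q) → ℚP.<-asym q<x x<q
  ; located     = λ p<q (p≮x , x≮q) → x≮q (ℚP.≤-<-trans (ℚP.≮⇒≥ p≮x) p<q)
  }

ℕ→ℚ : ℕ → ℚ
ℕ→ℚ n = + n / 1

fromℕ : ℕ → ℝ
fromℕ n = fromℚ (ℕ→ℚ n)

private
  L<U : ∀ x {p q} → L x p → U x q → p ℚ.< q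
  L<U x {p} {q} Lp Uq with ℚP.<-cmp p q
  ... | tri< p<q _ _  = p<q
  ... | tri≈ _ refl _ = ⊥-elim (disjoint x (Lp , Uq))
  ... | tri> _ _ q<p  = ⊥-elim (disjoint x (L-lower x q<p Lp , Uq))

  div-mul : ∀ a c .{{_ : ℚ.NonZero c}} → (a ℚ.* (ℚ.1/ c)) ℚ.* c ≡ a
  div-mul a c = trans (ℚP.*-assoc a (ℚ.1/ c) c)
                  (trans (cong (a ℚ.*_) (ℚP.*-inverseˡ c)) (ℚP.*-identityʳ a))

  mulL mulU : ℝ → ℕ → ℚ → Set
  mulL x n p = ∃[ s ] (L x s × p ℚ.< s ℚ.* ℕ→ℚ n)
  mulU x n q = ∃[ t ] (U x t × t ℚ.* ℕ→ℚ n ℚ.< q)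

  mul-disjoint : ∀ x n {q} → ¬ (mulL x n q × mulU x n q)
  mul-disjoint x n ((s , Ls , q<sn) , (t , Ut , tn<q)) =
    ℚP.<-irrefl refl (ℚP.<-≤-trans (ℚP.<-trans tn<q q<sn)
      (ℚP.*-monoʳ-≤-nonNeg (ℕ→ℚ n) {{ℚP.normalize-nonNeg n 1}} (ℚP.<⇒≤ (L<U x Ls Ut))))

  mul-located : ∀ x n {p q} → p ℚ.< q → ¬ (¬ mulL x n p × ¬ mulU x n q)
  mul-located x zero {p} {q} p<q (¬Lp , ¬Uq) with p ℚP.<? 0ℚ
  ... | yes p<0 = let (s , Ls) = L-inhabited x in
    ¬Lp (s , Ls , subst (p ℚ.<_) (sym (ℚP.*-zeroʳ s)) p<0)
  ... | no p≮0 = let (t , Ut) = U-inhabited x in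
    ¬Uq (t , Ut , subst (ℚ._< q) (sym (ℚP.*-zeroʳ t)) (ℚP.≤-<-trans (ℚP.≮⇒≥ p≮0) p<q))
  mul-located x (suc n) {p} {q} p<q (¬Lp , ¬Uq) = located x a/c<b/c
    ( (λ La → ¬Lp (a ℚ.* (ℚ.1/ c) , La , subst (p ℚ.<_) (sym (div-mul a c)) p<a))
    , (λ Ub → ¬Uq (b ℚ.* (ℚ.1/ c) , Ub , subst (ℚ._< q) (sym (div-mul b c)) b<q)) )
    where
    c = ℕ→ℚ (suc n)
    instance
      c-pos : ℚ.Positive c
      c-pos = ℚP.normalize-pos (suc n) 1
      c-nz : ℚ.NonZero c
      c-nz = ℚP.pos⇒nonZero c
    a-between = ℚP.<-dense p<q
    a = proj₁ a-between
    p<a = proj₁ (proj₂ a-between)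
    b-between = ℚP.<-dense (proj₂ (proj₂ a-between))
    b = proj₁ b-between
    a<b = proj₁ (proj₂ b-between)
    b<q = proj₂ (proj₂ b-between)
    a/c<b/c : a ℚ.* (ℚ.1/ c) ℚ.< b ℚ.* (ℚ.1/ c)
    a/c<b/c = ℚP.*-monoˡ-<-pos (ℚ.1/ c) {{ℚP.1/pos⇒pos c}} a<b

infixl 7 _*ℕ_

_*ℕ_ : ℝ → ℕ → ℝ
x *ℕ n = record
  { L           = λ p → ∃[ s ] (L x s × p ℚ.< s ℚ.* ℕ→ℚ n)
  ; U           = λ q → ∃[ t ] (U x t × t ℚ.* ℕ→ℚ n ℚ.< q)
  ; L-inhabited = let (s , Ls) = L-inhabited x in _ , s , Ls , p-1<p _
  ; U-inhabited = let (t , Ut) = U-inhabited x in _ , t , Ut , p<p+1 _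
  ; L-lower     = λ p<q (s , Ls , q<sn) → s , Ls , ℚP.<-trans p<q q<sn
  ; U-upper     = λ p<q (t , Ut , tn<p) → t , Ut , ℚP.<-trans tn<p p<q
  ; L-open      = λ (s , Ls , p<sn) →
      let (m , p<m , m<sn) = ℚP.<-dense p<sn in m , p<m , s , Ls , m<sn
  ; U-open      = λ (t , Ut , tn<q) →
      let (m , tn<m , m<q) = ℚP.<-dense tn<q in m , m<q , t , Ut , tn<m
  ; disjoint    = mul-disjoint x n
  ; located     = mul-located x n
  }

IsInfimum : ∀ {ℓ} → (ℝ → Set ℓ) → ℝ → Set (lsuc 0ℓ ⊔ ℓ)
IsInfimum S x = (∀ γ → S γ → x ≤ℝ γ) × (∀ y → (∀ γ → S γ → y ≤ℝ γ) → y ≤ℝ x)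

IsAccumulationPoint : ∀ {ℓ} → (ℝ → Set ℓ) → ℝ → Set (lsuc 0ℓ ⊔ ℓ)
IsAccumulationPoint A a =
  ∀ u v → u <ℝ a → a <ℝ v → ∃[ x ] (A x × ¬ (x ≈ℝ a) × u <ℝ x × x <ℝ v)

record Graph : Set where
  field
    order      : ℕ
    adj        : Fin order → Fin order → Bool
    adj-sym    : ∀ u v → adj u v ≡ adj v u
    adj-irrefl : ∀ v → adj v v ≡ false

  Vertex : Set
  Vertex = Fin order

  Adj : Vertex → Vertex → Set
  Adj u v = adj u v ≡ true

  neighbours : Vertex → Subset order
  neighbours v = tabulate (adj v)

  degree : Vertex → ℕ
  degree v = ∣ neighbours v ∣

  -- `order` is only the starting value of the minimum; every degree is below
  -- it, so it matters only for the graph without vertices.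
  minDegree : ℕ
  minDegree = min order (map degree (allFin order))

open Graph

IsHomomorphism : (G F : Graph) → (Vertex G → Vertex F) → Set
IsHomomorphism G F f = ∀ {u v} → Adj G u v → Adj F (f u) (f v)

_HomTo_ : Graph → Graph → Set
G HomTo F = ∃[ f ] IsHomomorphism G F f

-- A copy of H in G, not necessarily induced, is given by an injective
-- homomorphism from H to G.
_Contains_ : Graph → Graph → Set
G Contains H = ∃[ f ] (Injective _≡_ _≡_ f × IsHomomorphism H G f)

-- `H -free G` reads "G is H-free".
_-free_ : Graph → Graph → Set
H -free G = ¬ (G Contains H)

Colourable : Graph → ℕ → Set
Colourable G k = Σ[ c ∈ (Vertex G → Fin k) ] (∀ {u v} → Adj G u v → c u ≢ c v)

IsChromaticNumber : Graph → ℕ → Set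
IsChromaticNumber G r = Colourable G r × (∀ k → Colourable G k → r ℕ.≤ k)

HomThresholdSet : Graph → ℝ → Set
HomThresholdSet H γ =
  fromℚ 0ℚ ≤ℝ γ ×
  (Σ[ F ∈ Graph ] (H -free F ×
    (∀ G → H -free G → γ *ℕ order G ≤ℝ fromℕ (minDegree G) → G HomTo F)))

IsHomThreshold : Graph → ℝ → Set₁
IsHomThreshold H = IsInfimum (HomThresholdSet H)

Δhom : ℕ → ℝ → Set₁
Δhom r x = Σ[ H ∈ Graph ] (IsChromaticNumber H r × IsHomThreshold H x)

[r-2]/[r-1] : (r : ℕ) → 3 ℕ.≤ r → ℚ
[r-2]/[r-1] r 3≤r = (+ (r ∸ 2) / (r ∸ 1)) {{ℕ.>-nonZero (ℕP.m<n⇒0<n∸m (ℕP.<-trans (ℕP.n<1+n 1) 3≤r))}}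

{-# OPTIONS --safe #-}

-- Let H be K_r(r) together with s + 1 isolated vertices, and m = |H| − 1.  Since K_m is H-free, an H-free
-- target F contains K_m; as H minus an isolated vertex embeds in K_m, F has no further vertex.  So above
-- (r − 2)/(r − 1) the threshold of H asks when H-free graphs are m-colourable.
--
-- It exceeds (r − 2)/(r − 1): take a C₄-free graph D that is not m-colourable and has no isolated vertex.
-- The join of r − 1 copies of D is not m-colourable and contains no K_r(r), for in such a copy two classes
-- would each put two vertices into the same copy of D.  Its minimum degree is more than (r − 2)|D|.
--
-- It is at most any given γ > (r − 2)/(r − 1) once s is large: by the Erdős–Stone theorem the K_r(r)-free graphs
-- with δ ≥ γ n have bounded order, so H-free graphs of minimum degree γ n have at most m vertices and map to K_m.
module Submission where

open import Defs
open import Data.Bool using (Bool; true; false; _∧_; _∨_; not)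
import Data.Bool.Properties as BoolP
open import Data.Empty using (⊥; ⊥-elim)
open import Data.Fin using (Fin; zero; suc; punchIn; punchOut; combine; remQuot; _↑ʳ_; finToFun; funToFin; inject≤)
import Data.Fin.Properties as FinP
open import Data.Fin.Subset using (∣_∣)
open import Data.Integer as ℤ using (+_; -[1+_])
import Data.Integer.Properties as ℤP
open import Data.List using (map; allFin)
import Data.List.Relation.Unary.All.Properties as AllP
open import Data.Nat using (ℕ; zero; suc; _+_; _*_; _^_; _≤_; _<_; z≤n; s≤s)
import Data.Nat.Properties as ℕP
open import Data.List.Extrema ℕP.≤-totalOrder using (min≤xs; min≤⊤; v≤min⁺)
open import Data.Nat.Solver using (module +-*-Solver)
open import Data.Product using (_×_; _,_; proj₁; proj₂; ∃-syntax; Σ-syntax)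
open import Data.Rational as ℚ using (ℚ; 0ℚ; 1ℚ; mkℚ; _/_)
import Data.Rational.Properties as ℚP
open import Data.Rational.Unnormalised as ℚᵘ using (mkℚᵘ)
import Data.Rational.Unnormalised.Properties as ℚᵘP
open import Data.Sum using (_⊎_; inj₁; inj₂)
open import Data.Sum.Function.Propositional using (_⊎-↔_)
open import Data.Vec using (tabulate)
open import Function using (_∘_; id)
open import Function.Bundles using (_↔_; Inverse)
open import Function.Definitions using (Injective)
open import Function.Properties.Inverse using (↔-refl; ↔-trans)
open import Relation.Binary.Definitions using (tri<; tri≈; tri>)
open import Relation.Binary.PropositionalEquality
open import Relation.Nullary using (¬_; Dec; yes; no; does; contradiction)
open import Relation.Nullary.Decidable using (dec-true; dec-false; decidable-stable; _×-dec_; _→-dec_)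
open import Algebra.Properties.CommutativeMonoid.Sum ℕP.+-0-commutativeMonoid using (sum; sum-syntax; ∑-comm; ∑-distrib-+; sum-cong-≗)

open Graph

private
  variable
    m n k : ℕ

-- Counting

∑-mono : {f g : Fin n → ℕ} → (∀ i → f i ≤ g i) → sum f ≤ sum g
∑-mono {zero}  f≤g = z≤n
∑-mono {suc n} f≤g = ℕP.+-mono-≤ (f≤g zero) (∑-mono (f≤g ∘ suc))

∑-const : ∀ n c → ∑[ i < n ] c ≡ n * c
∑-const zero    c = refl
∑-const (suc n) c = cong (λ x → c + x) (∑-const n c)

∑-*ˡ : ∀ c (f : Fin n → ℕ) → ∑[ i < n ] (c * f i) ≡ c * sum f
∑-*ˡ {zero}  c f = sym (ℕP.*-zeroʳ c)
∑-*ˡ {suc n} c f =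
  trans (cong (λ x → c * f zero + x) (∑-*ˡ c (f ∘ suc))) (sym (ℕP.*-distribˡ-+ c (f zero) _))

∑-pigeonhole : ∀ q c (f : Fin (suc q) → ℕ) → suc q * c ≤ sum f → ∃[ i ] c ≤ f i
∑-pigeonhole q c f le with c ℕP.≤? f zero
... | yes c≤f₀ = zero , c≤f₀
∑-pigeonhole zero c f le | no c≰f₀ =
  contradiction (subst₂ _≤_ (ℕP.*-identityˡ c) (ℕP.+-identityʳ _) le) c≰f₀
∑-pigeonhole (suc q) c f le | no c≰f₀ =
  let i , c≤fᵢ = ∑-pigeonhole q c (f ∘ suc) rest in suc i , c≤fᵢ
  where
  rest : suc q * c ≤ sum (f ∘ suc)
  rest = ℕP.+-cancelˡ-≤ c _ _ (ℕP.≤-trans le (ℕP.+-monoˡ-≤ _ (ℕP.<⇒≤ (ℕP.≰⇒> c≰f₀))))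

𝟙 : Bool → ℕ
𝟙 true  = 1
𝟙 false = 0

# : (Fin n → Bool) → ℕ
# b = sum (𝟙 ∘ b)

Injection : ℕ → ℕ → Set
Injection m n = Σ[ f ∈ (Fin m → Fin n) ] Injective _≡_ _≡_ f

extract : ∀ t (b : Fin n → Bool) → t ≤ # b → Σ[ (g , _) ∈ Injection t n ] (∀ i → b (g i) ≡ true)
extract zero b _ = ((λ ()) , λ { {()} }) , λ ()
extract {zero} (suc t) b ()
extract {suc n} (suc t) b le with b zero in b₀
... | false = let (g , g-inj) , bg = extract (suc t) (b ∘ suc) le in
  (suc ∘ g , g-inj ∘ FinP.suc-injective) , bg
... | true  = let (g , g-inj) , bg = extract t (b ∘ suc) (ℕP.≤-pred le) in
  ((λ { zero → zero ; (suc i) → suc (g i) })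
  , λ { {zero} {zero} _ → refl ; {suc i} {suc j} e → cong suc (g-inj (FinP.suc-injective e)) })
  , λ { zero → b₀ ; (suc i) → bg i }

first : ∀ {x} → x ≡ true → Fin (𝟙 x + m)
first {x = true} _ = zero

first≢↑ʳ : ∀ {x} (e : x ≡ true) (j : Fin m) → first e ≢ 𝟙 x ↑ʳ j
first≢↑ʳ {x = true} e j ()

rank : (b : Fin n → Bool) (i : Fin n) → b i ≡ true → Fin (# b)
rank b zero    bi = first bi
rank b (suc i) bi = 𝟙 (b zero) ↑ʳ rank (b ∘ suc) i bi

rank-injective : (b : Fin n → Bool) (i j : Fin n) (bi : b i ≡ true) (bj : b j ≡ true) →
  rank b i bi ≡ rank b j bj → i ≡ j
rank-injective b zero    zero    bi bj e = refl
rank-injective b (suc i) (suc j) bi bj e =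
  cong suc (rank-injective (b ∘ suc) i j bi bj (FinP.↑ʳ-injective (𝟙 (b zero)) _ _ e))
rank-injective b zero    (suc j) bi bj e = contradiction e (first≢↑ʳ bi _)
rank-injective b (suc i) zero    bi bj e = contradiction (sym e) (first≢↑ʳ bj _)

-- Composing with `rank`, the position among the true indices, lands in `Fin (# b)`, and an
-- injection of finite sets bounds their sizes.
injection⇒≤# : (b : Fin n → Bool) (g : Fin k → Fin n) → Injective _≡_ _≡_ g → (∀ i → b (g i) ≡ true) → k ≤ # b
injection⇒≤# b g g-inj bg = FinP.injective⇒≤ {f = λ i → rank b (g i) (bg i)} (g-inj ∘ rank-injective b _ _ _ _)

#-true : (v : Fin n) (P : Fin n → Bool) → P v ≡ true → 1 ≤ # P
#-true v P Pv = injection⇒≤# {k = 1} P (λ _ → v) (λ { {zero} {zero} _ → refl }) (λ _ → Pv)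

#-∧ : (a b : Fin n → Bool) → # a + # b ≤ # (λ i → a i ∧ b i) + n
#-∧ {n} a b = begin
  # a + # b                                  ≡⟨ ∑-distrib-+ (𝟙 ∘ a) (𝟙 ∘ b) ⟨
  ∑[ i < n ] (𝟙 (a i) + 𝟙 (b i))             ≤⟨ ∑-mono (λ i → pt (a i) (b i)) ⟩
  ∑[ i < n ] (𝟙 (a i ∧ b i) + 1)             ≡⟨ ∑-distrib-+ (λ i → 𝟙 (a i ∧ b i)) (λ _ → 1) ⟩
  # (λ i → a i ∧ b i) + ∑[ i < n ] 1         ≡⟨ cong (λ x → # (λ i → a i ∧ b i) + x) (trans (∑-const n 1) (ℕP.*-identityʳ n)) ⟩
  # (λ i → a i ∧ b i) + n                    ∎
  where
  open ℕP.≤-Reasoning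
  pt : ∀ x y → 𝟙 x + 𝟙 y ≤ 𝟙 (x ∧ y) + 1
  pt true  true  = ℕP.≤-refl
  pt true  false = ℕP.≤-refl
  pt false true  = ℕP.≤-refl
  pt false false = z≤n

#-split : (X b : Fin n → Bool) → # X ≡ # (λ i → X i ∧ b i) + # (λ i → X i ∧ not (b i))
#-split X b = trans (sum-cong-≗ (λ i → pt (X i) (b i))) (∑-distrib-+ (λ i → 𝟙 (X i ∧ b i)) _)
  where
  pt : ∀ x y → 𝟙 x ≡ 𝟙 (x ∧ y) + 𝟙 (x ∧ not y)
  pt true  true  = refl
  pt true  false = refl
  pt false y     = refl

#≤n : (b : Fin n → Bool) → # b ≤ n
#≤n {n} b = ℕP.≤-trans (∑-mono (pt ∘ b)) (ℕP.≤-reflexive (trans (∑-const n 1) (ℕP.*-identityʳ n)))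
  where
  pt : ∀ x → 𝟙 x ≤ 1
  pt true  = ℕP.≤-refl
  pt false = z≤n

∧-true : ∀ {x y} → x ∧ y ≡ true → x ≡ true × y ≡ true
∧-true {true} {true} _ = refl , refl

does-true : {P : Set} (P? : Dec P) → does P? ≡ true → P
does-true (yes p) _ = p

-- By halving X once for each of the T predicates.
uniformise : ∀ T c (S : Fin T → Fin n → Bool) (X : Fin n → Bool) → 2 ^ T * c ≤ # X →
  Σ[ σ ∈ (Fin T → Bool) ] Σ[ Y ∈ (Fin n → Bool) ]
    (c ≤ # Y × (∀ v → Y v ≡ true → X v ≡ true × (∀ j → S j v ≡ σ j)))
uniformise zero c S X le = (λ ()) , X , subst (_≤ # X) (ℕP.*-identityˡ c) le , λ v Xv → Xv , λ ()
uniformise {n} (suc T) c S X le = pick (half (2 ^ T * c ℕP.≤? # (λ i → X i ∧ S zero i)))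
  where
  -- The two halves of `X` together have at least `2 * (2 ^ T * c)` points, so one of them has at
  -- least `2 ^ T * c`.
  half : Dec (2 ^ T * c ≤ # (λ i → X i ∧ S zero i)) →
         (2 ^ T * c ≤ # (λ i → X i ∧ S zero i)) ⊎ (2 ^ T * c ≤ # (λ i → X i ∧ not (S zero i)))
  half (yes p) = inj₁ p
  half (no ¬p) = inj₂ (ℕP.+-cancelˡ-≤ (2 ^ T * c) _ _ (begin
    2 ^ T * c + 2 ^ T * c ≡⟨ cong (λ x → 2 ^ T * c + x) (ℕP.+-identityʳ _) ⟨
    2 * (2 ^ T * c) ≡⟨ ℕP.*-assoc 2 (2 ^ T) c ⟨
    2 ^ suc T * c ≤⟨ le ⟩
    # X           ≡⟨ #-split X (S zero) ⟩
    # (λ i → X i ∧ S zero i) + # (λ i → X i ∧ not (S zero i)) ≤⟨ ℕP.+-monoˡ-≤ _ (ℕP.<⇒≤ (ℕP.≰⇒> ¬p)) ⟩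
    2 ^ T * c + # (λ i → X i ∧ not (S zero i)) ∎))
    where open ℕP.≤-Reasoning
  Goal = Σ[ σ ∈ (Fin (suc T) → Bool) ] Σ[ Y ∈ (Fin n → Bool) ]
    (c ≤ # Y × (∀ v → Y v ≡ true → X v ≡ true × (∀ j → S j v ≡ σ j)))
  extend : (x : Bool) (X′ : Fin n → Bool) → (∀ v → X′ v ≡ true → X v ≡ true × S zero v ≡ x) → 2 ^ T * c ≤ # X′ → Goal
  extend x X′ X′⊆ le′ =
    let σ , Y , c≤Y , Y⊆ = uniformise T c (S ∘ suc) X′ le′ in
    (λ { zero → x ; (suc j) → σ j }) , Y , c≤Y , λ v Yv →
      let X′v , Sv = Y⊆ v Yv ; Xv , S₀v = X′⊆ v X′v in
      Xv , λ { zero → S₀v ; (suc j) → Sv j }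
  pick : _ → Goal
  pick (inj₁ p) = extend true  (λ i → X i ∧ S zero i) (λ v → ∧-true) p
  pick (inj₂ p) = extend false (λ i → X i ∧ not (S zero i))
    (λ v e → let Xv , ¬Sv = ∧-true e in Xv , trans (sym (BoolP.not-involutive _)) (cong not ¬Sv)) p

-- With `T = D * t` sets this is `T * (2 ^ T * t)`: at least a `T`-th part of the points belongs to
-- `X`, and `T` halvings of `X` must leave `t` points.
KSTbound : ℕ → ℕ → ℕ
KSTbound D t = D * t * (2 ^ (D * t) * t)

-- The average point lies in t + 1 of the sets, so the set X of points lying in at least t + 1 of them is large;
-- many points of X lie in exactly the same sets.
kővári–sós–turán : ∀ D t (S : Fin (suc D * suc t) → Fin n → Bool) → (∀ j → n ≤ suc D * # (S j)) →
  KSTbound (suc D) (suc t) ≤ n →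
  Σ[ (g , _) ∈ Injection (suc t) (suc D * suc t) ] Σ[ (h , _) ∈ Injection (suc t) n ] (∀ x y → S (g x) (h y) ≡ true)
kővári–sós–turán {n} D t S dense large =
  let σ , Y , t<Y , Y⊆ = uniformise T (suc t) S X X-large
      (h , h-inj) , Yh = extract (suc t) Y t<Y
      Xh₀ , Sh₀ = Y⊆ (h zero) (Yh zero)
      -- All points of `Y` share the membership pattern `σ`, so the single point `h zero` of `X`
      -- shows that `σ` is true at least `t + 1` times.
      t<σ : suc t ≤ # σ
      t<σ = subst (suc t ≤_) (sum-cong-≗ (λ j → cong 𝟙 (Sh₀ j))) (X⇒ (h zero) Xh₀)
      (g , g-inj) , σg = extract (suc t) σ t<σ
  in (g , g-inj) , (h , h-inj) , λ x y → trans (proj₂ (Y⊆ (h y) (Yh y)) (g x)) (σg x)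
  where
  T = suc D * suc t
  d : Fin n → ℕ
  d v = # (λ j → S j v)
  X : Fin n → Bool
  X v = does (suc t ℕP.≤? d v)
  X⇒ : ∀ v → X v ≡ true → suc t ≤ d v
  X⇒ v = does-true (suc t ℕP.≤? d v)
  d≤ : ∀ v → d v ≤ t + T * 𝟙 (X v)
  d≤ v = cases (suc t ℕP.≤? d v)
    where
    cases : (p? : Dec (suc t ≤ d v)) → d v ≤ t + T * 𝟙 (does p?)
    cases (yes _) = ℕP.≤-trans (#≤n (λ j → S j v)) (ℕP.≤-trans (ℕP.≤-reflexive (sym (ℕP.*-identityʳ T))) (ℕP.m≤n+m _ t))
    cases (no ¬p) = ℕP.≤-trans (ℕP.≤-pred (ℕP.≰⇒> ¬p)) (ℕP.m≤m+n t _)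
  open ℕP.≤-Reasoning
  -- Double counting of incidences; the factor `suc D` of `T` cancels against the density, at least
  -- `1 / suc D`, of each set.
  lower : suc t * n ≤ sum d
  lower = ℕP.*-cancelˡ-≤ (suc D) (begin
    suc D * (suc t * n)                     ≡⟨ ℕP.*-assoc (suc D) (suc t) n ⟨
    T * n                                   ≡⟨ ∑-const T n ⟨
    ∑[ j < T ] n                            ≤⟨ ∑-mono dense ⟩
    ∑[ j < T ] (suc D * # (S j))            ≡⟨ ∑-*ˡ (suc D) (λ j → # (S j)) ⟩
    suc D * ∑[ j < T ] # (S j)              ≡⟨ cong (λ x → suc D * x) (∑-comm (λ j v → 𝟙 (S j v))) ⟩
    suc D * sum d                           ∎)
  upper : sum d ≤ t * n + T * # X
  upper = begin
    sum d                                   ≤⟨ ∑-mono d≤ ⟩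
    ∑[ v < n ] (t + T * 𝟙 (X v))            ≡⟨ ∑-distrib-+ {n} (λ _ → t) _ ⟩
    ∑[ v < n ] t + ∑[ v < n ] (T * 𝟙 (X v)) ≡⟨ cong₂ _+_ (trans (∑-const n t) (ℕP.*-comm n t)) (∑-*ˡ T (𝟙 ∘ X)) ⟩
    t * n + T * # X                         ∎
  n≤T*X : n ≤ T * # X
  n≤T*X = ℕP.+-cancelˡ-≤ (t * n) _ _ (begin
    t * n + n        ≡⟨ ℕP.+-comm (t * n) n ⟩
    suc t * n        ≤⟨ lower ⟩
    sum d            ≤⟨ upper ⟩
    t * n + T * # X  ∎)
  X-large : 2 ^ T * suc t ≤ # X
  X-large = ℕP.*-cancelˡ-≤ T (ℕP.≤-trans large n≤T*X)

-- Degrees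

degree≡# : ∀ G v → degree G v ≡ # (adj G v)
degree≡# G v = go (adj G v)
  where
  go : (b : Fin n → Bool) → ∣ tabulate b ∣ ≡ # b
  go {zero}  b = refl
  go {suc n} b with b zero
  ... | true  = cong suc (go (b ∘ suc))
  ... | false = go (b ∘ suc)

minDegree≤# : ∀ G v → minDegree G ≤ # (adj G v)
minDegree≤# G v = subst (minDegree G ≤_) (degree≡# G v)
  (AllP.tabulate⁻ (AllP.map⁻ (min≤xs (order G) (map (degree G) (allFin (order G))))) v)

≤minDegree : ∀ G k → k ≤ order G → (∀ v → k ≤ # (adj G v)) → k ≤ minDegree G
≤minDegree G k k≤n k≤# = v≤min⁺ k≤n
  (AllP.map⁺ (AllP.tabulate⁺ (λ v → subst (k ≤_) (sym (degree≡# G v)) (k≤# v))))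

-- The Erdős–Stone theorem for minimum degrees

-- Injectivity is asked within each class only: vertices of different classes are adjacent, hence
-- distinct.
Multipartite : Graph → ℕ → ℕ → Set
Multipartite G i t = Σ[ f ∈ (Fin i → Fin t → Vertex G) ]
  ((∀ a → Injective _≡_ _≡_ (f a)) × (∀ a b x y → a ≢ b → Adj G (f a x) (f b y)))

all : (Fin k → Bool) → Bool
all {zero}  b = true
all {suc k} b = b zero ∧ all (b ∘ suc)

all-true : (b : Fin k → Bool) → all b ≡ true → ∀ i → b i ≡ true
all-true b e zero    = proj₁ (∧-true e)
all-true b e (suc i) = all-true (b ∘ suc) (proj₂ (∧-true {b zero} e)) i

#-all : ∀ k δ (B : Fin k → Fin n → Bool) → (∀ a → δ ≤ # (B a)) → n + k * δ ≤ # (λ v → all (λ a → B a v)) + k * n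
#-all {n} zero δ B δ≤ = ℕP.≤-reflexive (cong (_+ 0) (sym (trans (∑-const n 1) (ℕP.*-identityʳ n))))
#-all {n} (suc k) δ B δ≤ = begin
  -- Iterated inclusion-exclusion: each further set removes at most `n - δ` points. The additive
  -- form avoids truncated subtraction.
  n + (δ + k * δ)              ≡⟨ solve 3 (λ n δ x → n :+ (δ :+ x) := δ :+ (n :+ x)) refl n δ (k * δ) ⟩
  δ + (n + k * δ)              ≤⟨ ℕP.+-mono-≤ (δ≤ zero) (#-all k δ (B ∘ suc) (δ≤ ∘ suc)) ⟩
  # (B zero) + (# C + k * n)   ≡⟨ ℕP.+-assoc (# (B zero)) (# C) (k * n) ⟨
  # (B zero) + # C + k * n     ≤⟨ ℕP.+-monoˡ-≤ (k * n) (#-∧ (B zero) C) ⟩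
  # (λ v → B zero v ∧ C v) + n + k * n ≡⟨ ℕP.+-assoc (# (λ v → B zero v ∧ C v)) n (k * n) ⟩
  # (λ v → B zero v ∧ C v) + (n + k * n) ∎
  where
  open ℕP.≤-Reasoning
  open +-*-Solver
  C : Fin n → Bool
  C v = all (λ a → B (suc a) v)

-- The condition δ/n ≥ (R − 1)/R + 1/(D R), cleared of denominators and subtractions.
Dense : ℕ → ℕ → ℕ → ℕ → Set
Dense D R n δ = D * (R * n) + n ≤ D * (R * δ) + D * n

-- Each set misses at most `n - δ` points, so `k ≤ R` of them together miss at most `R * (n - δ)`,
-- and `Dense` bounds this by `n - n / D`.
dense-common : ∀ D R {n δ} k (B : Fin k → Fin n → Bool) → Dense D R n δ → δ ≤ n → k ≤ R → (∀ a → δ ≤ # (B a)) →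
  n ≤ D * # (λ v → all (λ a → B a v))
dense-common D R {n} {δ} k B dense δ≤n k≤R δ≤ with ℕP.m≤n⇒∃[o]m+o≡n k≤R
-- The `l = R - k` missing sets are replaced by the full set, which `δ ≤ n` permits.
... | l , refl = ℕP.+-cancelˡ-≤ (D * ((k + l) * n)) _ _ (begin
  D * ((k + l) * n) + n               ≤⟨ dense ⟩
  D * ((k + l) * δ) + D * n           ≡⟨ solve 5 (λ D k l n δ →
                                           D :* ((k :+ l) :* δ) :+ D :* n := D :* (n :+ k :* δ) :+ D :* (l :* δ)) refl D k l n δ ⟩
  D * (n + k * δ) + D * (l * δ)       ≤⟨ ℕP.+-mono-≤
                                           (ℕP.*-monoʳ-≤ D (#-all k δ B δ≤)) (ℕP.*-monoʳ-≤ D (ℕP.*-monoʳ-≤ l δ≤n)) ⟩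
  D * (c + k * n) + D * (l * n)       ≡⟨ solve 5 (λ D k l n c →
                                           D :* (c :+ k :* n) :+ D :* (l :* n) := D :* ((k :+ l) :* n) :+ D :* c) refl D k l n c ⟩
  D * ((k + l) * n) + D * c           ∎)
  where
  open ℕP.≤-Reasoning
  open +-*-Solver
  c = # (λ v → all (λ a → B a v))

-- Class sizes are recorded minus one. The last class comes from `kővári–sós–turán`, applied to a
-- copy with one class fewer and class size `suc D * suc t`, which is `suc (t + D * suc t)`; the sum
-- is large enough for both steps.
ESbound : ℕ → ℕ → ℕ → ℕ
ESbound D zero    t = 0
ESbound D (suc i) t = KSTbound (suc D) (suc t) + ESbound D i (t + D * suc t)

-- The transversals of a copy of K_i(T) have dense common neighbourhoods; points common to t + 1 of these
-- extend the corresponding copy of K_i(t + 1) by one more class.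
module _ (G : Graph) (D R : ℕ) (dense : Dense (suc D) R (order G) (minDegree G)) where

  add-class : ∀ i t → i ≤ R → KSTbound (suc D) (suc t) ≤ order G → Multipartite G i (suc D * suc t) → Multipartite G (suc i) (suc t)
  add-class i t i≤R large (f , f-inj , f-adj) = build (kővári–sós–turán D t S S-dense large)
    where
    S : Fin (suc D * suc t) → Vertex G → Bool
    S j v = all (λ a → adj G (f a j) v)
    minDegree≤order : minDegree G ≤ order G
    minDegree≤order = min≤⊤ (order G) (map (degree G) (allFin (order G)))
    S-dense : ∀ j → order G ≤ suc D * # (S j)
    S-dense j = dense-common (suc D) R i (λ a → adj G (f a j)) dense minDegree≤order i≤R (λ a → minDegree≤# G (f a j))
    build : Σ[ (g , _) ∈ Injection (suc t) (suc D * suc t) ]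
            Σ[ (h , _) ∈ Injection (suc t) (order G) ] (∀ x y → S (g x) (h y) ≡ true) →
            Multipartite G (suc i) (suc t)
    build ((g , g-inj) , (h , h-inj) , Sgh) = f⁺ , f⁺-inj , f⁺-adj
      where
      f→h : ∀ a x y → Adj G (f a (g x)) (h y)
      f→h a x y = all-true (λ a → adj G (f a (g x)) (h y)) (Sgh x y) a
      f⁺ : Fin (suc i) → Fin (suc t) → Vertex G
      f⁺ zero    = h
      f⁺ (suc a) = f a ∘ g
      f⁺-inj : ∀ a → Injective _≡_ _≡_ (f⁺ a)
      f⁺-inj zero    = h-inj
      f⁺-inj (suc a) = g-inj ∘ f-inj a
      f⁺-adj : ∀ a b x y → a ≢ b → Adj G (f⁺ a x) (f⁺ b y)
      f⁺-adj zero    zero    x y a≢b = contradiction refl a≢b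
      f⁺-adj zero    (suc b) x y _   = trans (adj-sym G _ _) (f→h b y x)
      f⁺-adj (suc a) zero    x y _   = f→h a x y
      f⁺-adj (suc a) (suc b) x y a≢b = f-adj a b (g x) (g y) (a≢b ∘ cong suc)

  erdős–stone : ∀ i t → i ≤ suc R → ESbound D i t ≤ order G → Multipartite G i (suc t)
  erdős–stone zero    t _         _     = (λ ()) , (λ ()) , λ ()
  erdős–stone (suc i) t (s≤s i≤R) large =
    add-class i t i≤R (ℕP.≤-trans (ℕP.m≤m+n _ _) large)
      (erdős–stone i (t + D * suc t) (ℕP.m≤n⇒m≤1+n i≤R)
        (ℕP.≤-trans (ℕP.m≤n+m _ (KSTbound (suc D) (suc t))) large))

-- Graphs on finite types

module _ {V : Set} (enc : Fin n ↔ V) (E : V → V → Bool)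
         (E-sym : ∀ u v → E u v ≡ E v u) (E-irrefl : ∀ v → E v v ≡ false) where
  open Inverse enc using (to; from; strictlyInverseˡ)

  graphOn : Graph
  graphOn = record
    { order      = n
    ; adj        = λ u v → E (to u) (to v)
    ; adj-sym    = λ u v → E-sym (to u) (to v)
    ; adj-irrefl = λ v → E-irrefl (to v)
    }

  graphOn-adj : ∀ u v → E u v ≡ true → Adj graphOn (from u) (from v)
  graphOn-adj u v e = trans (cong₂ E (strictlyInverseˡ u) (strictlyInverseˡ v)) e

to-injective : {V : Set} (enc : Fin n ↔ V) → Injective _≡_ _≡_ (Inverse.to enc)
to-injective enc {u} {v} e = trans (sym (strictlyInverseʳ u)) (trans (cong from e) (strictlyInverseʳ v))
  where open Inverse enc

from-injective : {V : Set} (enc : Fin n ↔ V) → Injective _≡_ _≡_ (Inverse.from enc)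
from-injective enc {u} {v} e = trans (sym (strictlyInverseˡ u)) (trans (cong to e) (strictlyInverseˡ v))
  where open Inverse enc

≟-sym : (u v : Fin n) → does (u FinP.≟ v) ≡ does (v FinP.≟ u)
≟-sym u v = cases (u FinP.≟ v)
  where
  cases : (p? : Dec (u ≡ v)) → does p? ≡ does (v FinP.≟ u)
  cases (yes refl) = sym (dec-true (u FinP.≟ u) refl)
  cases (no  u≢v)  = sym (dec-false (v FinP.≟ u) (u≢v ∘ sym))

-- Graphs without 4-cycles of large chromatic number

-- Phrased through closed walks of length four, two opposite vertices of which must coincide. For
-- irreflexive symmetric relations this excludes exactly the 4-cycles.
C₄-Free : {V : Set} → (V → V → Bool) → Set
C₄-Free E = ∀ a b c d → E a b ≡ true → E b c ≡ true → E c d ≡ true → E d a ≡ true → a ≡ c ⊎ b ≡ d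

graphOn-C₄-Free : {V : Set} (enc : Fin n ↔ V) (E : V → V → Bool) → C₄-Free E →
  C₄-Free (λ u v → E (Inverse.to enc u) (Inverse.to enc v))
graphOn-C₄-Free enc E free a b c d ab bc cd da with free _ _ _ _ ab bc cd da
... | inj₁ e = inj₁ (to-injective enc e)
... | inj₂ e = inj₂ (to-injective enc e)

#-fibres : (c : Fin m → Fin (suc k)) → m ≤ ∑[ x < suc k ] # (λ i → does (c i FinP.≟ x))
#-fibres {m} {k} c = begin
  m                                            ≡⟨ trans (∑-const m 1) (ℕP.*-identityʳ m) ⟨
  ∑[ i < m ] 1                                 ≤⟨ ∑-mono (λ i → #-true (c i) (λ x → does (c i FinP.≟ x)) (dec-true (c i FinP.≟ c i) refl)) ⟩
  ∑[ i < m ] # (λ x → does (c i FinP.≟ x))        ≡⟨ ∑-comm (λ i x → 𝟙 (does (c i FinP.≟ x))) ⟩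
  ∑[ x < suc k ] # (λ i → does (c i FinP.≟ x))    ∎
  where open ℕP.≤-Reasoning

-- Blanche Descartes' construction: an independent set S of (k + 1) n points and, for every map φ from the
-- vertices of D to S, a copy of D whose vertex i is joined to φ(i) unless another vertex is sent to φ(i) too.
module Descartes (D : Graph) (k : ℕ) where
  n′ M : ℕ
  n′ = order D
  M  = suc k * n′

  V : Set
  V = Fin M ⊎ (Fin (M ^ n′) × Fin n′)

  Attached : Fin (M ^ n′) → Fin n′ → Fin M → Set
  Attached φ i s = finToFun φ i ≡ s × (∀ j → finToFun φ j ≡ s → j ≡ i)

  attached? : ∀ φ i s → Dec (Attached φ i s)
  attached? φ i s = (finToFun φ i FinP.≟ s) ×-dec FinP.all? (λ j → (finToFun φ j FinP.≟ s) →-dec (j FinP.≟ i))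

  E : V → V → Bool
  E (inj₁ s)       (inj₁ t)       = false
  E (inj₁ s)       (inj₂ (φ , i)) = does (attached? φ i s)
  E (inj₂ (φ , i)) (inj₁ s)       = does (attached? φ i s)
  E (inj₂ (φ , i)) (inj₂ (ψ , j)) = does (φ FinP.≟ ψ) ∧ adj D i j

  E-sym : ∀ u v → E u v ≡ E v u
  E-sym (inj₁ s)       (inj₁ t)       = refl
  E-sym (inj₁ s)       (inj₂ (φ , i)) = refl
  E-sym (inj₂ (φ , i)) (inj₁ s)       = refl
  E-sym (inj₂ (φ , i)) (inj₂ (ψ , j)) = cong₂ _∧_ (≟-sym φ ψ) (adj-sym D i j)

  E-irrefl : ∀ v → E v v ≡ false
  E-irrefl (inj₁ s)       = refl
  E-irrefl (inj₂ (φ , i)) = trans (cong (does (φ FinP.≟ φ) ∧_) (adj-irrefl D i)) (BoolP.∧-zeroʳ _)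

  E-same : ∀ φ ψ i j → E (inj₂ (φ , i)) (inj₂ (ψ , j)) ≡ true → φ ≡ ψ × Adj D i j
  E-same φ ψ i j e = let p , q = ∧-true e in does-true (φ FinP.≟ ψ) p , q

  E-attached : ∀ φ i s → does (attached? φ i s) ≡ true → Attached φ i s
  E-attached φ i s = does-true (attached? φ i s)

  -- The two edges stay in one copy of `D`, and the uniqueness clause of `Attached` gives `s` at
  -- most one neighbour in each copy.
  one-S : ∀ s φ i ψ j χ l → Attached φ i s → Attached χ l s →
          E (inj₂ (φ , i)) (inj₂ (ψ , j)) ≡ true → E (inj₂ (ψ , j)) (inj₂ (χ , l)) ≡ true →
          _≡_ {A = V} (inj₂ (φ , i)) (inj₂ (χ , l))
  one-S s φ i ψ j χ l (_ , i-only) (l↦s , _) e f with E-same φ ψ i j e | E-same ψ χ j l f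
  ... | refl , _ | refl , _ with refl ← i-only l l↦s = refl

  -- Points of S are never adjacent, so a closed 4-walk meets S at most in two opposite places. If
  -- in two, both are the image of a common neighbour under its map; if in one, `one-S` applies to
  -- the other three vertices; if in none, the walk stays in one copy of `D`.
  E-C₄-Free : C₄-Free (adj D) → C₄-Free E
  E-C₄-Free free (inj₁ s) (inj₂ (φ , i)) (inj₁ t) d p q _ _ =
    inj₁ (cong inj₁ (trans (sym (proj₁ (E-attached φ i s p))) (proj₁ (E-attached φ i t q))))
  E-C₄-Free free (inj₁ s) (inj₂ (φ , i)) (inj₂ (ψ , j)) (inj₂ (χ , l)) p q e f =
    inj₂ (one-S s φ i ψ j χ l (E-attached φ i s p) (E-attached χ l s f) q e)
  E-C₄-Free free (inj₂ (ψ , j)) (inj₁ s) (inj₂ (φ , i)) (inj₂ (χ , l)) p q e f =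
    inj₁ (sym (one-S s φ i χ l ψ j (E-attached φ i s q) (E-attached ψ j s p) e f))
  E-C₄-Free free (inj₂ (φ , i)) (inj₁ s) (inj₂ b) (inj₁ t) p q e f =
    inj₂ (cong inj₁ (trans (sym (proj₁ (E-attached φ i s p))) (proj₁ (E-attached φ i t f))))
  E-C₄-Free free (inj₂ (ψ , j)) (inj₂ (φ , i)) (inj₁ s) (inj₂ (χ , l)) p q e f =
    inj₂ (sym (one-S s χ l ψ j φ i (E-attached χ l s e) (E-attached φ i s q) f p))
  E-C₄-Free free (inj₂ (φ , i)) (inj₂ (ψ , j)) (inj₂ (χ , l)) (inj₁ s) p q e f =
    inj₁ (one-S s φ i ψ j χ l (E-attached φ i s f) (E-attached χ l s e) p q)
  E-C₄-Free free (inj₂ (φ , i)) (inj₂ (ψ , j)) (inj₂ (χ , l)) (inj₂ (ω , o)) p q e f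
    with E-same φ ψ i j p | E-same ψ χ j l q | E-same χ ω l o e | E-same ω φ o i f
  ... | refl , ij | refl , jl | refl , lo | refl , oi with free i j l o ij jl lo oi
  ... | inj₁ refl = inj₁ refl
  ... | inj₂ refl = inj₂ refl

  enc : Fin (M + M ^ n′ * n′) ↔ V
  enc = ↔-trans FinP.+↔⊎ (↔-refl ⊎-↔ FinP.*↔×)

  graph : Graph
  graph = graphOn enc E E-sym E-irrefl

  -- One of the `suc k` colours occurs on `n′` of the `suc k * n′` points of S. The copy of `D`
  -- attached to these by an injection avoids that colour, so the other `k` would colour `D`.
  not-colourable : ¬ Colourable D k → ¬ Colourable graph (suc k)
  not-colourable ¬D (c₀ , c₀-proper)
    with ∑-pigeonhole k n′ (λ x → # (λ s → does (c₀ (Inverse.from enc (inj₁ s)) FinP.≟ x)))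
           (#-fibres (λ s → c₀ (Inverse.from enc (inj₁ s))))
  ... | x , n≤class with extract n′ _ n≤class
  ... | (g , g-inj) , g∈class = 
    ¬D ((λ i → punchOut (avoid i)) , λ {i} {j} ij e →
      copy-proper ij (FinP.punchOut-injective (avoid i) (avoid j) e))
    where
    c : V → Fin (suc k)
    c = c₀ ∘ Inverse.from enc
    proper : ∀ u v → E u v ≡ true → c u ≢ c v
    proper u v e = c₀-proper (graphOn-adj enc E E-sym E-irrefl u v e)
    φ : Fin (M ^ n′)
    φ = funToFin g
    copy-proper : ∀ {i j} → Adj D i j → c (inj₂ (φ , i)) ≢ c (inj₂ (φ , j))
    copy-proper {i} {j} ij = proper (inj₂ (φ , i)) (inj₂ (φ , j)) (trans (cong (_∧ adj D i j) (dec-true (φ FinP.≟ φ) refl)) ij)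
    avoid : ∀ i → x ≢ c (inj₂ (φ , i))
    avoid i e = proper (inj₁ (g i)) (inj₂ (φ , i))
      -- Injectivity of `g` keeps every other vertex from being sent to `g i`, so each vertex of the
      -- copy is attached.
      (dec-true (attached? φ i (g i)) (φ≗g i , λ j φj → g-inj (trans (sym (φ≗g j)) φj)))
      (trans (does-true (c (inj₁ (g i)) FinP.≟ x) (g∈class i)) e)
      where
      φ≗g : ∀ j → finToFun φ j ≡ g j
      φ≗g = FinP.finToFun-funToFin g

C₄-free-chromatic : ∀ k → Σ[ D ∈ Graph ] (C₄-Free (adj D) × ¬ Colourable D k)
C₄-free-chromatic zero = record { order = 1 ; adj = λ _ _ → false ; adj-sym = λ _ _ → refl ; adj-irrefl = λ _ → refl }
  , (λ _ _ _ _ ()) , λ { (c , _) → FinP.¬Fin0 (c zero) }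
C₄-free-chromatic (suc k) with C₄-free-chromatic k
... | D , free , ¬col = Descartes.graph D k
  , graphOn-C₄-Free (Descartes.enc D k) (Descartes.E D k) (Descartes.E-C₄-Free D k free)
  , Descartes.not-colourable D k ¬col

-- Pendant edges remove isolated vertices without creating cycles.
module Corona (D : Graph) where
  V : Set
  V = Vertex D ⊎ Vertex D

  E : V → V → Bool
  E (inj₁ u) (inj₁ v) = adj D u v
  E (inj₁ u) (inj₂ v) = does (u FinP.≟ v)
  E (inj₂ u) (inj₁ v) = does (v FinP.≟ u)
  E (inj₂ u) (inj₂ v) = false

  E-sym : ∀ u v → E u v ≡ E v u
  E-sym (inj₁ u) (inj₁ v) = adj-sym D u v
  E-sym (inj₁ u) (inj₂ v) = refl
  E-sym (inj₂ u) (inj₁ v) = refl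
  E-sym (inj₂ u) (inj₂ v) = refl

  E-irrefl : ∀ v → E v v ≡ false
  E-irrefl (inj₁ v) = adj-irrefl D v
  E-irrefl (inj₂ v) = refl

  pendant : ∀ u v w → E v (inj₂ u) ≡ true → E w (inj₂ u) ≡ true → v ≡ w
  pendant u (inj₁ v) (inj₁ w) p q = cong inj₁ (trans (does-true (v FinP.≟ u) p) (sym (does-true (w FinP.≟ u) q)))

  E-C₄-Free : C₄-Free (adj D) → C₄-Free E
  E-C₄-Free free (inj₂ a) b c d p q e f = inj₂ (pendant a b d (trans (E-sym b (inj₂ a)) p) f)
  E-C₄-Free free a (inj₂ b) c d p q e f = inj₁ (pendant b a c p (trans (E-sym c (inj₂ b)) q))
  E-C₄-Free free a b (inj₂ c) d p q e f = inj₂ (pendant c b d q (trans (E-sym d (inj₂ c)) e))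
  E-C₄-Free free a b c (inj₂ d) p q e f = inj₁ (sym (pendant d c a e (trans (E-sym a (inj₂ d)) f)))
  E-C₄-Free free (inj₁ a) (inj₁ b) (inj₁ c) (inj₁ d) p q e f with free a b c d p q e f
  ... | inj₁ refl = inj₁ refl
  ... | inj₂ refl = inj₂ refl

  enc : Fin (order D + order D) ↔ V
  enc = FinP.+↔⊎

  graph : Graph
  graph = graphOn enc E E-sym E-irrefl

  neighbour : ∀ v → ∃[ w ] Adj graph v w
  neighbour v with Inverse.to enc v in e
  ... | inj₁ u = Inverse.from enc (inj₂ u)
    , trans (cong (E (inj₁ u)) (Inverse.strictlyInverseˡ enc (inj₂ u))) (dec-true (u FinP.≟ u) refl)
  ... | inj₂ u = Inverse.from enc (inj₁ u)
    , trans (cong (E (inj₂ u)) (Inverse.strictlyInverseˡ enc (inj₁ u))) (dec-true (u FinP.≟ u) refl)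

  not-colourable : ¬ Colourable D k → ¬ Colourable graph k
  not-colourable ¬D (c , c-proper) = ¬D (c ∘ Inverse.from enc ∘ inj₁
    , λ {u} {v} e → c-proper (graphOn-adj enc E E-sym E-irrefl (inj₁ u) (inj₁ v) e))

-- Joins of copies of a graph

module Join (R : ℕ) (D : Graph) where
  V : Set
  V = Fin R × Vertex D

  E : V → V → Bool
  E (a , x) (b , y) = not (does (a FinP.≟ b)) ∨ adj D x y

  E-sym : ∀ u v → E u v ≡ E v u
  E-sym (a , x) (b , y) = cong₂ (λ p q → not p ∨ q) (≟-sym a b) (adj-sym D x y)

  E-irrefl : ∀ v → E v v ≡ false
  E-irrefl (a , x) = cong₂ (λ p q → not p ∨ q) (dec-true (a FinP.≟ a) refl) (adj-irrefl D x)

  E-same : ∀ a x y → E (a , x) (a , y) ≡ adj D x y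
  E-same a x y = cong (λ p → not p ∨ adj D x y) (dec-true (a FinP.≟ a) refl)

  E-distinct : ∀ a b x y → a ≢ b → E (a , x) (b , y) ≡ true
  E-distinct a b x y a≢b = cong (λ p → not p ∨ adj D x y) (dec-false (a FinP.≟ b) a≢b)

  enc : Fin (R * order D) ↔ V
  enc = FinP.*↔×

  graph : Graph
  graph = graphOn enc E E-sym E-irrefl

  not-colourable : Fin R → ¬ Colourable D k → ¬ Colourable graph k
  not-colourable a ¬D (c , c-proper) = ¬D ((λ x → c (Inverse.from enc (a , x)))
    , λ {x} {y} e → c-proper (graphOn-adj enc E E-sym E-irrefl (a , x) (a , y) (trans (E-same a x y) e)))

  -- Pigeonhole twice: each class of `R + 1` vertices has two in one of the `R` copies of `D`, and
  -- two of the `R + 1` classes do so in the same copy, which gives a 4-cycle there.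
  not-multipartite : C₄-Free (adj D) → ¬ Multipartite graph (suc R) (suc R)
  not-multipartite free (f , f-inj , f-adj) with FinP.pigeonhole (ℕP.n<1+n R) part
    where
    copy : Vertex graph → Fin R
    copy v = proj₁ (Inverse.to enc v)
    part : Fin (suc R) → Fin R
    part α = copy (f α (proj₁ (FinP.pigeonhole (ℕP.n<1+n R) (copy ∘ f α))))
  ... | α , β , α<β , same with FinP.pigeonhole (ℕP.n<1+n R) (λ x → proj₁ (Inverse.to enc (f α x)))
                              | FinP.pigeonhole (ℕP.n<1+n R) (λ x → proj₁ (Inverse.to enc (f β x)))
  ... | x , y , x<y , xy | x′ , y′ , x′<y′ , xy′ =
    -- The cycle alternates between the classes `α` and `β`, so consecutive vertices are adjacent
    -- and opposite ones differ by injectivity within a class.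
    four (Inverse.to enc (f α x)) (Inverse.to enc (f β x′)) (Inverse.to enc (f α y)) (Inverse.to enc (f β y′))
      same (sym xy) (trans (sym xy′) (sym same))
      (f-adj α β x x′ α≢β) (f-adj β α x′ y (α≢β ∘ sym)) (f-adj α β y y′ α≢β) (f-adj β α y′ x (α≢β ∘ sym))
      (FinP.<⇒≢ x<y ∘ f-inj α ∘ to-injective enc) (FinP.<⇒≢ x′<y′ ∘ f-inj β ∘ to-injective enc)
    where
    α≢β : α ≢ β
    α≢β = FinP.<⇒≢ α<β
    four : ∀ u v w z → proj₁ u ≡ proj₁ v → proj₁ w ≡ proj₁ u → proj₁ z ≡ proj₁ u →
           E u v ≡ true → E v w ≡ true → E w z ≡ true → E z u ≡ true → u ≢ w → v ≢ z → ⊥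
    four (a , x) (_ , y) (_ , z) (_ , o) refl refl refl p q e f u≢w v≢z
      with free x y z o (trans (sym (E-same a x y)) p) (trans (sym (E-same a y z)) q)
                        (trans (sym (E-same a z o)) e) (trans (sym (E-same a o x)) f)
    ... | inj₁ refl = u≢w refl
    ... | inj₂ refl = v≢z refl

-- All vertices of the `R` other copies are neighbours; one neighbour inside the own copy supplies
-- the `suc`, which later lifts the degree ratio strictly above `a`.
join-degree : ∀ R D → (∀ x → ∃[ y ] Adj D x y) → ∀ v → suc (R * order D) ≤ # (adj (Join.graph (suc R) D) v)
join-degree R D nbr v = injection⇒≤# _ g g-inj g-adj
  where
  open Join (suc R) D
  a = proj₁ (Inverse.to enc v)
  x = proj₂ (Inverse.to enc v)
  h : Fin (suc (R * order D)) → V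
  h zero    = a , proj₁ (nbr x)
  h (suc i) = punchIn a (proj₁ (remQuot {R} (order D) i)) , proj₂ (remQuot {R} (order D) i)
  h-inj : Injective _≡_ _≡_ h
  h-inj {zero}  {zero}  e = refl
  h-inj {zero}  {suc j} e = contradiction (sym (cong proj₁ e)) (FinP.punchInᵢ≢i a _)
  h-inj {suc i} {zero}  e = contradiction (cong proj₁ e) (FinP.punchInᵢ≢i a _)
  h-inj {suc i} {suc j} e = cong suc (to-injective (FinP.*↔× {R} {order D})
    (cong₂ _,_ (FinP.punchIn-injective a _ _ (cong proj₁ e)) (cong proj₂ e)))
  g : Fin (suc (R * order D)) → Vertex graph
  g = Inverse.from enc ∘ h
  g-inj : Injective _≡_ _≡_ g
  g-inj = h-inj ∘ from-injective enc
  h-adj : ∀ i → E (a , x) (h i) ≡ true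
  h-adj zero    = trans (E-same a x _) (proj₂ (nbr x))
  h-adj (suc i) = E-distinct a _ x _ (FinP.punchInᵢ≢i a _ ∘ sym)
  g-adj : ∀ i → adj graph v (g i) ≡ true
  g-adj i = trans (cong (E (a , x)) (Inverse.strictlyInverseˡ enc (h i))) (h-adj i)

-- Complete graphs, complete multipartite graphs and isolated vertices

complete : ℕ → Graph
complete m = record
  { order      = m
  ; adj        = λ u v → not (does (u FinP.≟ v))
  ; adj-sym    = λ u v → cong not (≟-sym u v)
  ; adj-irrefl = λ v → cong not (dec-true (v FinP.≟ v) refl)
  }

complete-adj : {u v : Fin m} → u ≢ v → Adj (complete m) u v
complete-adj {u = u} {v} u≢v = cong not (dec-false (u FinP.≟ v) u≢v)

adj⇒≢ : ∀ G {u v} → Adj G u v → u ≢ v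
adj⇒≢ G {u} uv refl = contradiction (trans (sym uv) (adj-irrefl G u)) λ ()

complete-contains : ∀ G → complete (order G) Contains G
complete-contains G = id , id , complete-adj ∘ adj⇒≢ G

complete-free : ∀ {H} → m < order H → H -free complete m
complete-free m<H (f , f-inj , _) = FinP.<⇒notInjective m<H f-inj

order≤⇒HomTo-complete : ∀ G → order G ≤ m → G HomTo complete m
order≤⇒HomTo-complete G n≤m = (λ v → inject≤ v n≤m)
  , λ uv → complete-adj (adj⇒≢ G uv ∘ FinP.inject≤-injective n≤m n≤m _ _)

HomTo⇒Colourable : ∀ {G F} → G HomTo F → order F ≤ k → Colourable G k
HomTo⇒Colourable {F = F} (f , f-hom) F≤k = (λ v → inject≤ (f v) F≤k)
  , λ uv → adj⇒≢ F (f-hom uv) ∘ FinP.inject≤-injective F≤k F≤k _ _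

complete-HomTo⇒Contains : ∀ F → complete m HomTo F → F Contains complete m
complete-HomTo⇒Contains F (f , f-hom) = f , f-inj , f-hom
  where
  f-inj : Injective _≡_ _≡_ f
  f-inj {u} {v} e with u FinP.≟ v
  ... | yes u≡v = u≡v
  ... | no  u≢v = contradiction e (adj⇒≢ F (f-hom (complete-adj u≢v)))

Contains-trans : ∀ {G H K} → G Contains H → H Contains K → G Contains K
Contains-trans (f , f-inj , f-hom) (g , g-inj , g-hom) = f ∘ g , g-inj ∘ f-inj , f-hom ∘ g-hom

complete-minDegree : ∀ m → m ≤ minDegree (complete (suc m))
complete-minDegree m = ≤minDegree (complete (suc m)) m (ℕP.n≤1+n m) λ v →
  injection⇒≤# (adj (complete (suc m)) v) (punchIn v) (FinP.punchIn-injective v _ _) (λ i → complete-adj (FinP.punchInᵢ≢i v i ∘ sym))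

multipartite : ℕ → ℕ → Graph
multipartite r t = graphOn (FinP.*↔× {r} {t}) (λ u v → not (does (proj₁ u FinP.≟ proj₁ v)))
  (λ u v → cong not (≟-sym (proj₁ u) (proj₁ v))) (λ v → cong not (dec-true (proj₁ v FinP.≟ proj₁ v) refl))

multipartite-adj : ∀ r t a b x y → a ≢ b → Adj (multipartite r t) (combine {r} {t} a x) (combine b y)
multipartite-adj r t a b x y a≢b =
  trans (cong₂ (λ u v → not (does (u FinP.≟ v)))
          (cong proj₁ (FinP.remQuot-combine {r} {t} a x)) (cong proj₁ (FinP.remQuot-combine {r} {t} b y)))
        (cong not (dec-false (a FinP.≟ b) a≢b))

multipartite-adj⁻ : ∀ r t {u v} → Adj (multipartite r t) u v → proj₁ (remQuot {r} t u) ≢ proj₁ (remQuot {r} t v)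
multipartite-adj⁻ r t {u} e u≡v =
  contradiction (trans (sym e) (cong not (dec-true (_ FinP.≟ _) u≡v))) λ ()

Contains⇒Multipartite : ∀ {G} r t → G Contains multipartite r t → Multipartite G r t
Contains⇒Multipartite r t (f , f-inj , f-hom) = (λ a x → f (combine a x))
  , (λ a e → FinP.combine-injectiveʳ a _ a _ (f-inj e))
  , λ a b x y a≢b → f-hom (multipartite-adj r t a b x y a≢b)

Multipartite⇒Contains : ∀ {G} r t → Multipartite G r t → G Contains multipartite r t
Multipartite⇒Contains {G} r t (f , f-inj , f-adj) = g ∘ remQuot {r} t , to-injective (FinP.*↔× {r} {t}) ∘ g-inj _ _
  , λ e → f-adj _ _ _ _ (multipartite-adj⁻ r t e)
  where
  g : Fin r × Fin t → Vertex G
  g (a , x) = f a x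
  g-inj : ∀ u v → g u ≡ g v → u ≡ v
  g-inj (a , x) (b , y) e with a FinP.≟ b
  ... | yes refl = cong (a ,_) (f-inj a e)
  ... | no  a≢b  = contradiction e (adj⇒≢ G (f-adj a b x y a≢b))

addIsolated : Graph → Graph
addIsolated G = record { order = suc (order G) ; adj = E ; adj-sym = E-sym ; adj-irrefl = E-irrefl }
  where
  E : Fin (suc (order G)) → Fin (suc (order G)) → Bool
  E (suc u) (suc v) = adj G u v
  E zero    _       = false
  E (suc _) zero    = false
  E-sym : ∀ u v → E u v ≡ E v u
  E-sym zero    zero    = refl
  E-sym zero    (suc v) = refl
  E-sym (suc u) zero    = refl
  E-sym (suc u) (suc v) = adj-sym G u v
  E-irrefl : ∀ v → E v v ≡ false
  E-irrefl zero    = refl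
  E-irrefl (suc v) = adj-irrefl G v

addIsolated-contains : ∀ H → addIsolated H Contains H
addIsolated-contains H = suc , FinP.suc-injective , id

-- If every `w` were hit, choosing preimages would inject `Fin n` into the smaller `Fin m`.
fresh : (f : Fin m → Fin n) → m < n → ∃[ w ] (∀ i → f i ≢ w)
fresh {m} {n} f m<n
  with w , unhit ← FinP.¬∀⟶∃¬ n (λ w → ∃[ i ] f i ≡ w) (λ w → FinP.any? (λ i → f i FinP.≟ w))
         (λ onto → FinP.<⇒notInjective {f = proj₁ ∘ onto} m<n
           (λ {u} {v} e → trans (sym (proj₂ (onto u))) (trans (cong f e) (proj₂ (onto v)))))
  = w , λ i e → unhit (i , e)

contains-addIsolated : ∀ {F} H → F Contains H → order H < order F → F Contains addIsolated H
contains-addIsolated {F} H (f , f-inj , f-hom) H<F with fresh f H<F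
... | w , f≢w = g , g-inj , λ {u} {v} → g-hom u v
  where
  g : Fin (suc (order H)) → Vertex F
  g zero    = w
  g (suc i) = f i
  g-inj : Injective _≡_ _≡_ g
  g-inj {zero}  {zero}  e = refl
  g-inj {zero}  {suc j} e = contradiction (sym e) (f≢w j)
  g-inj {suc i} {zero}  e = contradiction e (f≢w i)
  g-inj {suc i} {suc j} e = cong suc (f-inj e)
  g-hom : ∀ u v → Adj (addIsolated H) u v → Adj F (g u) (g v)
  g-hom (suc u) (suc v) uv = f-hom uv

addIsolated^ : ℕ → Graph → Graph
addIsolated^ zero    H = H
addIsolated^ (suc s) H = addIsolated (addIsolated^ s H)

order-addIsolated^ : ∀ s H → order (addIsolated^ s H) ≡ s + order H
order-addIsolated^ zero    H = refl
order-addIsolated^ (suc s) H = cong suc (order-addIsolated^ s H)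

addIsolated^-contains : ∀ s H → addIsolated^ s H Contains H
addIsolated^-contains zero    H = id , id , id
addIsolated^-contains (suc s) H =
  Contains-trans {addIsolated^ (suc s) H} {addIsolated^ s H} {H}
    (addIsolated-contains (addIsolated^ s H)) (addIsolated^-contains s H)

contains-addIsolated^ : ∀ {F} s H → F Contains H → order (addIsolated^ s H) ≤ order F → F Contains addIsolated^ s H
contains-addIsolated^ zero    H H⊆F _   = H⊆F
contains-addIsolated^ {F} (suc s) H H⊆F s≤F =
  contains-addIsolated {F} (addIsolated^ s H) (contains-addIsolated^ {F} s H H⊆F (ℕP.<⇒≤ s≤F)) s≤F

Colourable-addIsolated : ∀ H → Colourable H (suc k) → Colourable (addIsolated H) (suc k)
Colourable-addIsolated {k} H (c , c-proper) = c⁺ , λ {u} {v} → c⁺-proper u v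
  where
  c⁺ : Fin (suc (order H)) → Fin (suc k)
  c⁺ zero    = zero
  c⁺ (suc v) = c v
  c⁺-proper : ∀ u v → Adj (addIsolated H) u v → c⁺ u ≢ c⁺ v
  c⁺-proper (suc u) (suc v) = c-proper

Colourable-addIsolated^ : ∀ s H → Colourable H (suc k) → Colourable (addIsolated^ s H) (suc k)
Colourable-addIsolated^ zero    H c = c
Colourable-addIsolated^ (suc s) H c = Colourable-addIsolated (addIsolated^ s H) (Colourable-addIsolated^ s H c)

chromatic-number : ∀ s r t → IsChromaticNumber (addIsolated^ s (multipartite (suc r) (suc t))) (suc r)
chromatic-number s r t = Colourable-addIsolated^ s K (proj₁ ∘ remQuot {suc r} (suc t) , λ {u} {v} → multipartite-adj⁻ (suc r) (suc t) {u} {v})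
  , λ k (c , c-proper) →
      let f , _ , f-hom = addIsolated^-contains s K
          transversal : Fin (suc r) → Fin k
          transversal a = c (f (combine a (zero {t})))
          transversal-inj : Injective _≡_ _≡_ transversal
          transversal-inj {a} {b} e = decidable-stable (a FinP.≟ b)
            (λ a≢b → c-proper (f-hom (multipartite-adj (suc r) (suc t) a b zero zero a≢b)) e)
      in FinP.injective⇒≤ transversal-inj
  where
  K = multipartite (suc r) (suc t)

-- Rational arithmetic

toℚᵘ-/ : ∀ a b → ℚ.toℚᵘ (+ a / suc b) ℚᵘ.≃ mkℚᵘ (+ a) b
toℚᵘ-/ a b = ℚP.toℚᵘ-fromℚᵘ (mkℚᵘ (+ a) b)

/-mono-< : ∀ a b c d → a * suc d < c * suc b → + a / suc b ℚ.< + c / suc d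
/-mono-< a b c d ad<cb = ℚP.toℚᵘ-cancel-<
  (ℚᵘP.<-respˡ-≃ (ℚᵘP.≃-sym (toℚᵘ-/ a b)) (ℚᵘP.<-respʳ-≃ (ℚᵘP.≃-sym (toℚᵘ-/ c d))
    (ℚᵘ.*<* (subst₂ ℤ._<_ (ℤP.pos-* a (suc d)) (ℤP.pos-* c (suc b)) (ℤ.+<+ ad<cb)))))

/-*-cancel : ∀ k n → (+ k / suc n) ℚ.* ℕ→ℚ (suc n) ≡ ℕ→ℚ k
/-*-cancel k n = ℚP.toℚᵘ-injective (begin
  ℚ.toℚᵘ ((+ k / suc n) ℚ.* ℕ→ℚ (suc n))           ≈⟨ ℚP.toℚᵘ-homo-* (+ k / suc n) (ℕ→ℚ (suc n)) ⟩
  ℚ.toℚᵘ (+ k / suc n) ℚᵘ.* ℚ.toℚᵘ (ℕ→ℚ (suc n))   ≈⟨ ℚᵘP.*-cong (toℚᵘ-/ k n) (toℚᵘ-/ (suc n) 0) ⟩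
  mkℚᵘ (+ k) n ℚᵘ.* mkℚᵘ (+ suc n) 0               ≈⟨ ℚᵘ.*≡* (ℤP.*-assoc (+ k) (+ suc n) (+ 1)) ⟩
  mkℚᵘ (+ k) 0                                     ≈⟨ toℚᵘ-/ k 0 ⟨
  ℚ.toℚᵘ (ℕ→ℚ k)                                   ∎)
  where open ℚᵘP.≃-Reasoning

ℕ→ℚ-mono-≤ : m ≤ n → ℕ→ℚ m ℚ.≤ ℕ→ℚ n
ℕ→ℚ-mono-≤ {m} {n} m≤n = ℚP.toℚᵘ-cancel-≤
  (ℚᵘP.≤-respˡ-≃ (ℚᵘP.≃-sym (toℚᵘ-/ m 0)) (ℚᵘP.≤-respʳ-≃ (ℚᵘP.≃-sym (toℚᵘ-/ n 0))
    (ℚᵘ.*≤* (subst₂ ℤ._≤_ (ℤP.pos-* m 1) (ℤP.pos-* n 1) (ℤ.+≤+ (ℕP.*-monoˡ-≤ 1 m≤n))))))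

/<⇒ : ∀ a b p P → ℚ.↥ p ≡ + P → + a / suc b ℚ.< p → a * ℚ.↧ₙ p < P * suc b
/<⇒ a b (mkℚ _ D c) P refl lt with ℚᵘP.<-respˡ-≃ (toℚᵘ-/ a b) (ℚP.toℚᵘ-mono-< lt)
... | ℚᵘ.*<* lt′ = ℤP.drop‿+<+ (subst₂ ℤ._<_ (sym (ℤP.pos-* a (suc D))) (sym (ℤP.pos-* P (suc b))) lt′)

*≤⇒ : ∀ p P n d → ℚ.↥ p ≡ + P → p ℚ.* ℕ→ℚ n ℚ.≤ ℕ→ℚ d → P * n ≤ d * ℚ.↧ₙ p
*≤⇒ p@(mkℚ _ D c) P n d refl le
  with ℚᵘP.≤-respˡ-≃
         (ℚᵘP.≃-trans (ℚP.toℚᵘ-homo-* p (ℕ→ℚ n)) (ℚᵘP.*-congˡ {mkℚᵘ (+ P) D} (toℚᵘ-/ n 0)))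
         (ℚᵘP.≤-respʳ-≃ (toℚᵘ-/ d 0) (ℚP.toℚᵘ-mono-≤ le))
... | ℚᵘ.*≤* le′ = ℤP.drop‿+≤+ (subst₂ ℤ._≤_ lhs rhs le′)
  where
  lhs : (+ P ℤ.* + n) ℤ.* + 1 ≡ + (P * n)
  lhs = trans (ℤP.*-identityʳ _) (sym (ℤP.pos-* P n))
  rhs : + d ℤ.* + (suc D * 1) ≡ + (d * suc D)
  rhs = trans (sym (ℤP.pos-* d (suc D * 1))) (cong (λ x → + (d * x)) (ℕP.*-identityʳ (suc D)))

positive-numerator : ∀ a b q → + a / suc b ℚ.< q → ∃[ P ] ℚ.↥ q ≡ + P
positive-numerator a b (mkℚ (+ P) D c)    lt = P , refl
positive-numerator a b (mkℚ -[1+ P ] D c) lt =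
  contradiction
    (ℚP.<-trans (ℚP.≤-<-trans (ℚP.nonNegative⁻¹ (+ a / suc b) {{ℚP.normalize-nonNeg a (suc b)}}) lt) (ℚP.negative⁻¹ _))
    (ℚP.<-irrefl refl)

<-⊓ : ∀ {p q r} → p ℚ.< q → p ℚ.< r → p ℚ.< q ℚ.⊓ r
<-⊓ {p} {q} {r} p<q p<r with ℚP.⊓-sel q r
... | inj₁ e = subst (p ℚ.<_) (sym e) p<q
... | inj₂ e = subst (p ℚ.<_) (sym e) p<r

-- Real thresholds

-- The rational `p` strictly below `q` is the kind of witness that the lower cut of the product asks
-- for.
<⇒*ℕ≤ : ∀ {p q} n d → p ℚ.< q → fromℚ q *ℕ n ≤ℝ fromℕ d → p ℚ.* ℕ→ℚ n ℚ.≤ ℕ→ℚ d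
<⇒*ℕ≤ {p} n d p<q qn≤d = ℚP.≮⇒≥ λ d<pn →
  let m , d<m , m<pn = ℚP.<-dense d<pn in qn≤d (m , d<m , p , p<q , m<pn)

≤/⇒*ℕ≤ : ∀ {γ} G k n → order G ≡ suc n → γ ℚ.≤ + k / suc n → k ≤ minDegree G →
  fromℚ γ *ℕ order G ≤ℝ fromℕ (minDegree G)
≤/⇒*ℕ≤ {γ} G k n refl γ≤k/n k≤δ (q , δ<q , s , s<γ , q<sn) = ℚP.<-irrefl refl (begin-strict
  q                              <⟨ q<sn ⟩
  s ℚ.* ℕ→ℚ (suc n)              ≤⟨ ℚP.*-monoʳ-≤-nonNeg (ℕ→ℚ (suc n)) {{ℚP.normalize-nonNeg (suc n) 1}}
                                      (ℚP.≤-trans (ℚP.<⇒≤ s<γ) γ≤k/n) ⟩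
  (+ k / suc n) ℚ.* ℕ→ℚ (suc n)  ≡⟨ /-*-cancel k n ⟩
  ℕ→ℚ k                          ≤⟨ ℕ→ℚ-mono-≤ k≤δ ⟩
  ℕ→ℚ (minDegree G)              <⟨ δ<q ⟩
  q                              ∎)
  where open ℚP.≤-Reasoning

L<U : ∀ x {p q} → ℝ.L x p → ℝ.U x q → p ℚ.< q
L<U x {p} {q} Lp Uq with ℚP.<-cmp p q
... | tri< p<q _ _  = p<q
... | tri≈ _ refl _ = contradiction (Lp , Uq) (ℝ.disjoint x)
... | tri> _ _ q<p  = contradiction (Lp , ℝ.U-upper x q<p Uq) (ℝ.disjoint x)

-- A larger `q` leaves fewer graphs to map, so the same `F` serves; this lets the rational members
-- alone determine the infimum.
HomThresholdSet-upward : ∀ H γ q → ℝ.U γ q → HomThresholdSet H γ → HomThresholdSet H (fromℚ q)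
HomThresholdSet-upward H γ q Uq (0≤γ , F , F-free , F-univ) =
  (λ { (s , q<s , s<0) → 0≤γ (s , ℝ.U-upper γ q<s Uq , s<0) })
  , F , F-free , λ G G-free qn≤δ → F-univ G G-free
    (λ { (e , δ<e , s , Ls , e<sn) → qn≤δ (e , δ<e , s , L<U γ Ls Uq , e<sn) })

module Threshold (H : Graph) (p₀ : ℚ) (p₀∈ : HomThresholdSet H (fromℚ p₀)) where

  Member : ℚ → Set
  Member γ = HomThresholdSet H (fromℚ γ)

  0≤member : ∀ {γ} → Member γ → 0ℚ ℚ.≤ γ
  0≤member (0≤γ , _) = ℚP.≮⇒≥ λ γ<0 → let m , γ<m , m<0 = ℚP.<-dense γ<0 in 0≤γ (m , γ<m , m<0)

  threshold : ℝ
  threshold = record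
    { L           = λ p → ∃[ q ] (p ℚ.< q × (∀ γ → Member γ → q ℚ.≤ γ))
    ; U           = λ q → ∃[ p ] (p ℚ.< q × Member p)
    ; L-inhabited = ℚ.- 1ℚ , 0ℚ , ℚP.negative⁻¹ (ℚ.- 1ℚ) , λ γ → 0≤member
    ; U-inhabited = p₀ ℚ.+ 1ℚ , p₀
        , subst (ℚ._< p₀ ℚ.+ 1ℚ) (ℚP.+-identityʳ p₀) (ℚP.+-monoʳ-< p₀ (ℚP.positive⁻¹ 1ℚ)) , p₀∈
    ; L-lower     = λ p<q (l , q<l , lower) → l , ℚP.<-trans p<q q<l , lower
    ; U-upper     = λ p<q (l , l<p , l∈) → l , ℚP.<-trans l<p p<q , l∈
    ; L-open      = λ (l , p<l , lower) → let m , p<m , m<l = ℚP.<-dense p<l in m , p<m , l , m<l , lower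
    ; U-open      = λ (l , l<q , l∈) → let m , l<m , m<q = ℚP.<-dense l<q in m , m<q , l , l<m , l∈
    ; disjoint    = λ ((l , q<l , lower) , (p , p<q , p∈)) →
        ℚP.<-irrefl refl (ℚP.<-≤-trans (ℚP.<-trans p<q q<l) (lower p p∈))
    -- If no member lies below `q`, the intermediate `m` is a lower bound and `p` falls into the
    -- lower cut.
    ; located     = λ p<q (¬L , ¬U) → let m , p<m , m<q = ℚP.<-dense p<q in
        ¬L (m , p<m , λ γ γ∈ → ℚP.≮⇒≥ λ γ<m → ¬U (γ , ℚP.<-trans γ<m m<q , γ∈))
    }

  isHomThreshold : IsHomThreshold H threshold
  isHomThreshold =
    (λ { γ γ∈ (q , Uq , l , q<l , lower) →
         ℚP.<-irrefl refl (ℚP.<-≤-trans q<l (lower q (HomThresholdSet-upward H γ q Uq γ∈))) })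
    , λ { y y-lower (q , (p , p<q , p∈) , Lq) → y-lower (fromℚ p) p∈ (q , p<q , Lq) }

-- Thresholds of the forbidden graphs

¬Colourable⇒nonempty : ∀ G → ¬ Colourable G k → ∃[ n ] order G ≡ suc n
¬Colourable⇒nonempty G ¬col = cases (order G) refl
  where
  cases : ∀ n → order G ≡ n → ∃[ n ] order G ≡ suc n
  cases (suc n) e = n , e
  cases zero    e = contradiction ((λ v → ⊥-elim (empty v)) , λ {u} → ⊥-elim (empty u)) ¬col
    where
    empty : ¬ Vertex G
    empty v = FinP.¬Fin0 (subst Fin e v)

module Forbidden (ρ : ℕ) where

  a : ℚ
  a = + ρ / suc ρ

  K : Graph
  K = multipartite (2 + ρ) (2 + ρ)

  forbidden : ℕ → Graph
  forbidden s = addIsolated^ (suc s) K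

  -- One less than the order of `forbidden s`, hence the order of the largest complete graph free of
  -- it.
  size : ℕ → ℕ
  size s = order (addIsolated^ s K)

  -- F contains the complete graph on all but one vertex of H, and the remaining vertex of H is isolated.
  target-small : ∀ s F → forbidden s -free F → complete (size s) HomTo F → order F ≤ size s
  target-small s F F-free K→F = ℕP.≮⇒≥ λ size<F → F-free
    (contains-addIsolated {F} (addIsolated^ s K)
      (Contains-trans {F} {complete (size s)} {addIsolated^ s K} (complete-HomTo⇒Contains F K→F) (complete-contains (addIsolated^ s K)))
      size<F)

  -- `P / suc D` exceeds `ρ / suc ρ`, and distinct fractions with these denominators differ by at
  -- least `1 / (suc D * suc ρ)`, the excess that `Dense` demands.
  dense : ∀ P D n δ → ρ * suc D < P * suc ρ → P * n ≤ δ * suc D → Dense (suc D) (suc ρ) n δ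
  dense P D n δ a<p pn≤δ = begin
    suc D * (suc ρ * n) + n               ≡⟨ solve 3 (λ D ρ n → D :* ((con 1 :+ ρ) :* n) :+ n := (con 1 :+ ρ :* D) :* n :+ D :* n) refl (suc D) ρ n ⟩
    suc (ρ * suc D) * n + suc D * n       ≤⟨ ℕP.+-monoˡ-≤ (suc D * n) (ℕP.*-monoˡ-≤ n a<p) ⟩
    P * suc ρ * n + suc D * n             ≡⟨ solve 4 (λ P r n D → P :* r :* n :+ D :* n := r :* (P :* n) :+ D :* n) refl P (suc ρ) n (suc D) ⟩
    suc ρ * (P * n) + suc D * n           ≤⟨ ℕP.+-monoˡ-≤ (suc D * n) (ℕP.*-monoʳ-≤ (suc ρ) pn≤δ) ⟩
    suc ρ * (δ * suc D) + suc D * n       ≡⟨ solve 4 (λ r δ D n → r :* (δ :* D) :+ D :* n := D :* (r :* δ) :+ D :* n) refl (suc ρ) δ (suc D) n ⟩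
    suc D * (suc ρ * δ) + suc D * n       ∎
    where
    open ℕP.≤-Reasoning
    open +-*-Solver

  upper-from : ∀ {p q} P s → ℚ.↥ p ≡ + P → a ℚ.< p → p ℚ.< q → ESbound (ℚ.denominator-1 p) (2 + ρ) (suc ρ) ≤ s →
    HomThresholdSet (forbidden s) (fromℚ q)
  upper-from {p} {q} P s ↥p≡P a<p p<q bound≤s =
      (λ (e , q<e , e<0) → ℚP.<-irrefl refl (ℚP.<-trans (ℚP.≤-<-trans 0≤a (ℚP.<-trans (ℚP.<-trans a<p p<q) q<e)) e<0))
    , complete (size s) , complete-free {H = forbidden s} (ℕP.n<1+n _) , λ G → hom G (order G ℕP.≤? size s)
    where
    D = ℚ.denominator-1 p
    0≤a : 0ℚ ℚ.≤ a
    0≤a = ℚP.nonNegative⁻¹ a {{ℚP.normalize-nonNeg ρ (suc ρ)}}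
    s≤size : s ≤ size s
    s≤size = ℕP.≤-trans (ℕP.m≤m+n s (order K)) (ℕP.≤-reflexive (sym (order-addIsolated^ s K)))
    K⊆ : ∀ G → size s < order G → fromℚ q *ℕ order G ≤ℝ fromℕ (minDegree G) → G Contains K
    K⊆ G large qn≤δ = Multipartite⇒Contains {G} (2 + ρ) (2 + ρ)
      (erdős–stone G D (suc ρ)
        (dense P D (order G) (minDegree G) (/<⇒ ρ ρ p P ↥p≡P a<p)
          (*≤⇒ p P (order G) (minDegree G) ↥p≡P (<⇒*ℕ≤ (order G) (minDegree G) p<q qn≤δ)))
        -- For `R = suc ρ` at most `2 + ρ` classes are available, and the argument `suc ρ` stands
        -- for classes of `2 + ρ` vertices.
        (2 + ρ) (suc ρ) ℕP.≤-refl (ℕP.≤-trans bound≤s (ℕP.≤-trans s≤size (ℕP.<⇒≤ large))))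
    hom : ∀ G → Dec (order G ≤ size s) → forbidden s -free G → fromℚ q *ℕ order G ≤ℝ fromℕ (minDegree G) →
          G HomTo complete (size s)
    hom G (yes small) G-free qn≤δ = order≤⇒HomTo-complete G small
    -- A graph this dense with more than `size s` vertices contains `K` and has room for all
    -- isolated vertices, so it is not free of `forbidden s`.
    hom G (no ¬small) G-free qn≤δ = contradiction
      (contains-addIsolated^ {G} (suc s) K (K⊆ G (ℕP.≰⇒> ¬small) qn≤δ) (ℕP.≰⇒> ¬small)) G-free

  upper : ∀ q → a ℚ.< q → ∃[ s ] HomThresholdSet (forbidden s) (fromℚ q)
  upper q a<q =
    let p , a<p , p<q = ℚP.<-dense a<q
        P , ↥p≡P = positive-numerator ρ ρ p a<p
    in ESbound (ℚ.denominator-1 p) (2 + ρ) (suc ρ) , upper-from {p} {q} P _ ↥p≡P a<p p<q ℕP.≤-refl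

  -- Two test graphs give the bound: the complete graph of order `size s` forces the target to be
  -- small, and the join `G` then has no map into it. Below the smaller of `β₁` and `β₂` both
  -- satisfy the degree condition.
  lower-from : ∀ s B → C₄-Free (adj B) → ¬ Colourable B (size s) →
    ∃[ β ] (a ℚ.< β × (∀ γ → HomThresholdSet (forbidden s) (fromℚ γ) → β ℚ.≤ γ))
  lower-from s B B-C₄-free ¬B = bound (¬Colourable⇒nonempty G ¬G) size≡
    where
    module D = Corona B
    module J = Join (suc ρ) D.graph
    N = order D.graph
    G : Graph
    G = J.graph
    ¬G : ¬ Colourable G (size s)
    ¬G = J.not-colourable zero (D.not-colourable ¬B)
    G-free : forbidden s -free G
    G-free H⊆G = J.not-multipartite (graphOn-C₄-Free D.enc D.E (D.E-C₄-Free B-C₄-free))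
      (Contains⇒Multipartite {G} (2 + ρ) (2 + ρ) (Contains-trans {G} {forbidden s} {K} H⊆G (addIsolated^-contains (suc s) K)))
    size≡ : ∃[ m ] (size s ≡ suc m × ρ < m)
    -- `order K` is `(2 + ρ) * (2 + ρ)`, which unfolds to the successor of the bracket.
    size≡ = s + (suc ρ + suc ρ * (2 + ρ))
      , trans (order-addIsolated^ s K) (ℕP.+-suc s _)
      , ℕP.≤-trans (ℕP.m≤m+n (suc ρ) _) (ℕP.m≤n+m _ s)
    bound : ∃[ n ] order G ≡ suc n → ∃[ m ] (size s ≡ suc m × ρ < m) →
            ∃[ β ] (a ℚ.< β × (∀ γ → HomThresholdSet (forbidden s) (fromℚ γ) → β ℚ.≤ γ))
    bound (n , n≡) (m , m≡ , ρ<m) = β₁ ℚ.⊓ β₂ , a<β , λ γ γ∈ → ℚP.≮⇒≥ λ γ<β → impossible γ γ∈ (ℚP.<⇒≤ γ<β)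
      where
      κ : ℕ
      κ = suc (ρ * N)
      β₁ β₂ : ℚ
      β₁ = + κ / suc n
      β₂ = + m / suc m
      open ℕP.≤-Reasoning
      open +-*-Solver
      a<β₁ : a ℚ.< β₁
      a<β₁ = /-mono-< ρ ρ κ n (begin-strict
        ρ * suc n                 ≡⟨ cong (ρ *_) n≡ ⟨
        ρ * (suc ρ * N)           ≡⟨ solve 3 (λ x r N → x :* (r :* N) := x :* N :* r) refl ρ (suc ρ) N ⟩
        -- The gain `suc ρ` comes from the extra neighbour counted in `κ`.
        ρ * N * suc ρ             <⟨ ℕP.m<n+m (ρ * N * suc ρ) {suc ρ} (s≤s z≤n) ⟩
        suc (ρ * N) * suc ρ       ∎)
      a<β₂ : a ℚ.< β₂
      a<β₂ = /-mono-< ρ ρ m m (begin-strict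
        ρ * suc m                 ≡⟨ ℕP.*-suc ρ m ⟩
        ρ + ρ * m                 <⟨ ℕP.+-monoˡ-< (ρ * m) ρ<m ⟩
        suc ρ * m                 ≡⟨ ℕP.*-comm (suc ρ) m ⟩
        m * suc ρ                 ∎)
      a<β : a ℚ.< β₁ ℚ.⊓ β₂
      a<β = <-⊓ a<β₁ a<β₂
      G-degree : ∀ v → κ ≤ # (adj G v)
      G-degree = join-degree ρ D.graph D.neighbour
      G-minDegree : κ ≤ minDegree G
      -- `minDegree` starts its minimum at the order, so `κ` must not exceed the order; the degree
      -- of a vertex of the nonempty `G` shows this.
      G-minDegree = ≤minDegree G κ (ℕP.≤-trans (G-degree v₀) (#≤n (adj G v₀))) G-degree
        where
        v₀ : Vertex G
        v₀ = subst Fin (sym n≡) zero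
      K-minDegree : m ≤ minDegree (complete (size s))
      K-minDegree = subst (λ x → m ≤ minDegree (complete x)) (sym m≡) (complete-minDegree m)
      impossible : ∀ γ → HomThresholdSet (forbidden s) (fromℚ γ) → γ ℚ.≤ β₁ ℚ.⊓ β₂ → ⊥
      impossible γ (_ , F , F-free , univ) γ≤β = ¬G (HomTo⇒Colourable {G = G} {F = F}
        (univ G G-free (≤/⇒*ℕ≤ G κ n n≡ (ℚP.≤-trans γ≤β (ℚP.p⊓q≤p β₁ β₂)) G-minDegree))
        (target-small s F F-free
          (univ (complete (size s)) (complete-free {H = forbidden s} (ℕP.n<1+n _))
            (≤/⇒*ℕ≤ (complete (size s)) m m m≡ (ℚP.≤-trans γ≤β (ℚP.p⊓q≤q β₁ β₂)) K-minDegree))))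

  lower : ∀ s → ∃[ β ] (a ℚ.< β × (∀ γ → HomThresholdSet (forbidden s) (fromℚ γ) → β ℚ.≤ γ))
  lower s = let B , B-C₄-free , ¬B = C₄-free-chromatic (size s) in lower-from s B B-C₄-free ¬B

  -- For a suitable `s` the threshold of `forbidden s` lies between `β` and `p`, where `a < β` and
  -- `p < q`: strictly above `a`, yet below `v`.
  accumulation : IsAccumulationPoint (Δhom (2 + ρ)) (fromℚ a)
  accumulation u v (e , Ue , e<a) (q , a<q , Lq) =
    let p , a<p , p<q = ℚP.<-dense a<q ; s , p∈ = upper p a<p in near p s p<q p∈ (lower s)
    where
    near : ∀ p s → p ℚ.< q → HomThresholdSet (forbidden s) (fromℚ p) →
           ∃[ β ] (a ℚ.< β × (∀ γ → HomThresholdSet (forbidden s) (fromℚ γ) → β ℚ.≤ γ)) →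
           ∃[ x ] (Δhom (2 + ρ) x × ¬ (x ≈ℝ fromℚ a) × u <ℝ x × x <ℝ v)
    near p s p<q p∈ (β , a<β , β-lower) = threshold
      , (forbidden s , chromatic-number (suc s) (suc ρ) (suc ρ) , isHomThreshold)
      -- A rational strictly between `a` and `β` separates the threshold from `a`.
      , (λ (x≤a , _) → let b , a<b , b<β = ℚP.<-dense a<β in x≤a (b , a<b , β , b<β , β-lower))
      , (e , Ue , β , ℚP.<-trans e<a a<β , β-lower)
      , (q , (p , p<q , p∈) , Lq)
      where open Threshold (forbidden s) p p∈

theorem1p3 : (r : ℕ) (3≤r : 3 ≤ r) → IsAccumulationPoint (Δhom r) (fromℚ ([r-2]/[r-1] r 3≤r))
theorem1p3 (suc (suc ρ)) (s≤s (s≤s _)) = Forbidden.accumulation ρ
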